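{- Let $m \geq 2$, $n \geq 1$ and $k \geq 0$ be integers. Then $$\vert\mathrm{Inc}_k(m\times n)\vert = \sum_{\ell=k}^{(m-1)(n-1)} \binom{\ell}{k} \, N(m,n,\ell).$$
   Context: For a partition $\lambda$ of $N$, an increasing $\lambda$-tableau is a filling of the Young diagram of $\lambda$ with positive integers such that rows (left to right) and columns (top to bottom) are strictly increasing and, if $N-k$ is the largest entry, every integer $i$ with $1\le i\le N-k$ appears at least once. $\mathrm{Inc}_k(\lambda)$ denotes the set of increasing $\lambda$-tableaux with maximum entry $N-k$, and $\mathrm{Inc}_k(m\times n)=\mathrm{Inc}_k(n^m)$ is the case of the rectangular shape with $m$ rows and $n$ columns ($N=mn$). Let $\mathcal{C}(m,n)$ be the set of lattice paths in $\mathbb{R}^m$ from $(0,\dots,0)$ to $(n,\dots,n)$ using unit steps $X_1=(1,0,\dots,0),\dots,X_m=(0,\dots,0,1)$ and staying in the region $\{(x_1,\dots,x_m): 0\le x_m\le x_{m-1}\le\cdots\le x_1\}$. For a path $P=\epsilon_1\cdots\epsilon_{mn}$, an ascent is an index $i$ with $\epsilon_{i-1}\epsilon_i=X_jX_r$ and $r<j$. For $m\ge 2$ and $0\le \ell\le (m-1)(n-1)$, the $m$-Narayana number $N(m,n,\ell)$ is the number of paths in $\mathcal{C}(m,n)$ with exactly $\ell$ ascents. -}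

module Defs where

open import Data.Nat using (ℕ; zero; suc; _+_; _*_; _∸_; _≤_; _<_)
open import Data.Nat.Combinatorics using (_C_)
open import Data.Fin as Fin using (Fin)
open import Data.Vec using (Vec; lookup; toList)
open import Data.List using (List; []; _∷_; take; length; map; upTo)
open import Data.Nat.ListAction using (sum)
open import Data.Product using (Σ; ∃; ∃-syntax; _×_)
open import Relation.Binary.PropositionalEquality using (_≡_)
open import Relation.Nullary.Decidable using (does)
open import Data.Bool using (if_then_else_)

entry : ∀ {m n} → Vec (Vec ℕ n) m → Fin m → Fin n → ℕ
entry t i j = lookup (lookup t i) j

record IsIncTableau (k m n : ℕ) (t : Vec (Vec ℕ n) m) : Set where
  field
    positive  : ∀ i j → 1 ≤ entry t i j
    bounded   : ∀ i j → entry t i j ≤ m * n ∸ k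
    rowsInc   : ∀ i (j j' : Fin n) → j Fin.< j' → entry t i j < entry t i j'
    colsInc   : ∀ (i i' : Fin m) j → i Fin.< i' → entry t i j < entry t i' j
    surjective : ∀ v → 1 ≤ v → v ≤ m * n ∸ k → ∃[ i ] ∃[ j ] entry t i j ≡ v

record Inc (k m n : ℕ) : Set where
  constructor mkInc
  field
    tableau : Vec (Vec ℕ n) m
    .valid  : IsIncTableau k m n tableau

-- Lattice paths in C(m,n).  A path is the word of its m*n steps,
-- the step X_{j+1} being encoded by  j : Fin m .

-- number of occurrences of step j in a word (= coordinate x_{j+1}
-- of the point reached)
count : ∀ {m} → Fin m → List (Fin m) → ℕ
count j []       = 0
count j (a ∷ w)  = (if does (a Fin.≟ j) then 1 else 0) + count j w

ascents : ∀ {m} → List (Fin m) → ℕ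
ascents []            = 0
ascents (a ∷ [])      = 0
ascents (a ∷ b ∷ w)   = (if does (b Fin.<? a) then 1 else 0) + ascents (b ∷ w)

record IsPath (m n : ℕ) (w : Vec (Fin m) (m * n)) : Set where
  field
    inRegion : ∀ (p : ℕ) (i j : Fin m) → i Fin.< j →
               count j (take p (toList w)) ≤ count i (take p (toList w))
    endpoint : ∀ (j : Fin m) → count j (toList w) ≡ n

record PathAsc (m n ℓ : ℕ) : Set where
  constructor mkPath
  field
    steps   : Vec (Fin m) (m * n)
    .valid  : IsPath m n steps
    .nAsc   : ascents (toList steps) ≡ ℓ

rhsSum : (m n k : ℕ) → (ℕ → ℕ) → ℕ
rhsSum m n k N =
  sum (map (λ j → ((k + j) C k) * N (k + j))
           (upTo (suc ((m ∸ 1) * (n ∸ 1)) ∸ k)))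

{-# OPTIONS --safe #-}

-- List the cells of an increasing tableau by value and, for equal values, from
-- the bottom row to the top row.  The rows of the listed cells form a path in
-- C(m,n), and two consecutive cells can share a value exactly at an ascent: the
-- step to a strictly higher row excludes a common row, and also a common column
-- since the higher cell of a column is listed first.  So a tableau in Inc_k is
-- a path together with k of its ascents, and a path with ℓ ascents admits
-- binom(ℓ,k) choices.  Choosing all the ascents of a path gives an increasing
-- tableau; its first row and last column form a chain of m + n - 1 cells,
-- whence ℓ ≤ (m-1)(n-1).
module Submission where

open import Defs
open import Algebra.Properties.CommutativeMonoid.Sum as Sum using ()
open import Data.Bool using (if_then_else_)
open import Data.Empty using (⊥-elim; ⊥-elim-irr)
open import Data.Fin as Fin using (Fin; zero; suc; toℕ; fromℕ; fromℕ<; opposite)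
import Data.Fin.Properties as Fin
open import Data.List as List using (List; []; _∷_; length; map; take; drop; filter; cartesianProduct; applyUpTo)
import Data.List.Properties as List
open import Data.List.Membership.Propositional using (_∈_)
open import Data.List.Membership.Propositional.Properties using (∈-filter⁺; ∈-filter⁻; ∈-cartesianProduct⁺; ∈-cartesianProduct⁻; ∈-applyUpTo⁺; ∈-applyUpTo⁻; ∈-tabulate⁺)
open import Data.List.Relation.Binary.Pointwise using (Pointwise; []; _∷_)
open import Data.List.Relation.Unary.All as All using (All; []; _∷_)
import Data.List.Relation.Unary.All.Properties as All
open import Data.List.Relation.Unary.AllPairs as AllPairs using (AllPairs; []; _∷_)
import Data.List.Relation.Unary.AllPairs.Properties as AllPairs
open import Data.List.Relation.Unary.Any using (here; there)
open import Data.Nat using (ℕ; zero; suc; _+_; _*_; _∸_; _≤_; _<_; z≤n; s≤s)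
open import Data.Nat.Combinatorics using (_C_; nCn≡1; nCk+nC[k+1]≡[n+1]C[k+1]; k>n⇒nCk≡0)
open import Data.Nat.ListAction using (sum)
open import Data.Nat.Properties
open import Data.List.Membership.DecPropositional _≟_ using (_∈?_)
open import Data.Product using (Σ-syntax; ∃-syntax; _×_; _,_; proj₁; proj₂)
open import Data.Product.Algebra using (Σ-assoc; ×-comm)
open import Data.Product.Function.Dependent.Propositional using (Σ-↔)
open import Data.Product.Function.NonDependent.Propositional using (_×-↔_)
import Data.Product.Properties as Product
open import Data.Sum using (_⊎_; inj₁; inj₂)
open import Data.Sum.Function.Propositional using (_⊎-↔_)
open import Data.Vec using (Vec; []; _∷_; lookup; toList; tabulate)
import Data.Vec.Properties as Vec
open import Function using (_∘_)
open import Function.Bundles using (_↔_; mk↔ₛ′; Inverse)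
open import Function.Properties.Inverse using (↔-refl; ↔-sym; ↔-trans)
open import Relation.Binary.Definitions using (Asymmetric)
open import Relation.Binary.PropositionalEquality using (_≡_; refl; sym; trans; cong; cong₂; subst; subst₂)
open import Relation.Nullary using (Dec; yes; no; contradiction; does)
open import Relation.Nullary.Decidable using (recompute)

-- Sorted lists.

-- Distinct heads would each occur in the other's tail, hence precede each other. Sorted lists of
-- cells and rows of values can thus be compared by membership alone.
sorted-unique : ∀ {A : Set} {_≺_ : A → A → Set} → Asymmetric _≺_ →
  ∀ {xs ys} → AllPairs _≺_ xs → AllPairs _≺_ ys →
  (∀ {z} → z ∈ xs → z ∈ ys) → (∀ {z} → z ∈ ys → z ∈ xs) → xs ≡ ys
sorted-unique asym {[]}     {[]}     _ _ _ _ = refl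
sorted-unique asym {[]}     {y ∷ ys} _ _ _ g with () ← g (here refl)
sorted-unique asym {x ∷ xs} {[]}     _ _ f _ with () ← f (here refl)
sorted-unique {_≺_ = _≺_} asym {x ∷ xs} {y ∷ ys} (x≺ ∷ xs↗) (y≺ ∷ ys↗) f g
  = cong₂ _∷_ x≡y (sorted-unique asym xs↗ ys↗
      (λ {z} z∈ → tail x≺ z∈ (subst (λ u → z ∈ u ∷ ys) (sym x≡y) (f (there z∈))))
      (λ {z} z∈ → tail y≺ z∈ (subst (λ u → z ∈ u ∷ xs) x≡y (g (there z∈)))))
  where
  heads : x ∈ y ∷ ys → y ∈ x ∷ xs → x ≡ y
  heads (here x≡y)  _           = x≡y
  heads (there _)   (here y≡x)  = sym y≡x
  heads (there x∈)  (there y∈)  = ⊥-elim (asym (All.lookup x≺ y∈) (All.lookup y≺ x∈))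
  x≡y : x ≡ y
  x≡y = heads (f (here refl)) (g (here refl))
  tail : ∀ {u z us vs} → All (u ≺_) us → z ∈ us → z ∈ u ∷ vs → z ∈ vs
  tail u≺ z∈ (here refl) = ⊥-elim (asym (All.lookup u≺ z∈) (All.lookup u≺ z∈))
  tail _  _  (there z∈)  = z∈

drop-< : ∀ {A : Set} d (ys : List A) → d < length ys →
  ∃[ y ] y ∈ ys × drop d ys ≡ y ∷ drop (suc d) ys
drop-< zero    (y ∷ ys) _         = y , here refl , refl
drop-< (suc d) (y ∷ ys) (s≤s d<n) with drop-< d ys d<n
... | z , z∈ , eq = z , there z∈ , eq

-- Cells and their reading order.

-- A tableau is recorded as the list of its cells (value , row), sorted by
-- value and, among equal values, from the bottom row to the top row.
Cell : ℕ → Set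
Cell m = ℕ × Fin m

module _ {m : ℕ} where

  infix 4 _≺_
  _≺_ : Cell m → Cell m → Set
  (v , a) ≺ (u , b) = v < u ⊎ (v ≡ u × b Fin.< a)

  ≺-asym : Asymmetric _≺_
  ≺-asym (inj₁ v<u)        (inj₁ u<v)         = <-asym v<u u<v
  ≺-asym (inj₁ v<u)        (inj₂ (refl , _))  = <-irrefl refl v<u
  ≺-asym (inj₂ (refl , _)) (inj₁ u<v)         = <-irrefl refl u<v
  ≺-asym (inj₂ (_ , b<a))  (inj₂ (_ , a<b))   = <-asym b<a a<b

  ≺-trans : ∀ {p q r} → p ≺ q → q ≺ r → p ≺ r
  ≺-trans (inj₁ v<u)          (inj₁ u<w)          = inj₁ (<-trans v<u u<w)
  ≺-trans (inj₁ v<u)          (inj₂ (refl , _))   = inj₁ v<u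
  ≺-trans (inj₂ (refl , _))   (inj₁ u<w)          = inj₁ u<w
  ≺-trans (inj₂ (refl , b<a)) (inj₂ (refl , c<b)) = inj₂ (refl , <-trans c<b b<a)

  row : Fin m → List (Cell m) → List ℕ
  row i []             = []
  row i ((v , a) ∷ ps) = if does (a Fin.≟ i) then v ∷ row i ps else row i ps

  word : List (Cell m) → List (Fin m)
  word = map proj₂

  length-row : ∀ i ps → length (row i ps) ≡ count i (word ps)
  length-row i []             = refl
  length-row i ((v , a) ∷ ps) with a Fin.≟ i
  ... | yes _ = cong suc (length-row i ps)
  ... | no  _ = length-row i ps

  ∈-row⁻ : ∀ i ps {u} → u ∈ row i ps → (u , i) ∈ ps
  ∈-row⁻ i ((v , a) ∷ ps) u∈ with a Fin.≟ i
  ∈-row⁻ i ((v , a) ∷ ps) (here refl) | yes refl = here refl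
  ∈-row⁻ i ((v , a) ∷ ps) (there u∈)  | yes refl = there (∈-row⁻ i ps u∈)
  ∈-row⁻ i ((v , a) ∷ ps) u∈          | no _     = there (∈-row⁻ i ps u∈)

  ∈-row⁺ : ∀ i ps {u} → (u , i) ∈ ps → u ∈ row i ps
  ∈-row⁺ i ((v , a) ∷ ps) u∈ with a Fin.≟ i
  ∈-row⁺ i ((v , a) ∷ ps) (here refl) | yes _   = here refl
  ∈-row⁺ i ((v , a) ∷ ps) (there u∈)  | yes _   = there (∈-row⁺ i ps u∈)
  ∈-row⁺ i ((v , a) ∷ ps) (here refl) | no a≢i  = contradiction refl a≢i
  ∈-row⁺ i ((v , a) ∷ ps) (there u∈)  | no _    = ∈-row⁺ i ps u∈

  -- Ties are listed from the bottom up, so a tie would put the earlier cell in a strictly lower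
  -- row.
  ≺⇒< : ∀ {v u a b} → a Fin.≤ b → (v , a) ≺ (u , b) → v < u
  ≺⇒< a≤b (inj₁ v<u)       = v<u
  ≺⇒< a≤b (inj₂ (_ , b<a)) = contradiction b<a (≤⇒≯ a≤b)

  ≺⇒≤ : ∀ {v u a b} → (v , a) ≺ (u , b) → v ≤ u
  ≺⇒≤ (inj₁ v<u)        = <⇒≤ v<u
  ≺⇒≤ (inj₂ (refl , _)) = ≤-refl

  row-sorted : ∀ i {ps} → AllPairs _≺_ ps → AllPairs _<_ (row i ps)
  row-sorted i [] = []
  row-sorted i {(v , a) ∷ ps} (p≺ ∷ ps↗) with a Fin.≟ i
  ... | yes refl = All.tabulate (≺⇒< (≤-refl {toℕ i}) ∘ All.lookup p≺ ∘ ∈-row⁻ i ps) ∷ row-sorted i ps↗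
  ... | no _     = row-sorted i ps↗

  -- Strict columns and the ballot condition.

  -- The offset d is the lead of row i over row j among the cells already read;
  -- a cell of row i precedes a cell of row j > i exactly when its value is smaller.
  module _ {i j : Fin m} (i<j : i Fin.< j) where

    columns⇒ballot : ∀ d ps → AllPairs _≺_ ps →
      length (row j ps) ≡ d + length (row i ps) →
      Pointwise _<_ (row i ps) (drop d (row j ps)) →
      ∀ p → count j (take p (word ps)) ≤ d + count i (take p (word ps))
    columns⇒ballot d ps _ _ _ zero = z≤n
    columns⇒ballot d [] _ _ _ (suc p) = z≤n
    columns⇒ballot d ((v , a) ∷ ps) (p≺ ∷ ps↗) len cols (suc p) with a Fin.≟ i | a Fin.≟ j
    ... | yes refl | yes refl = contradiction i<j (<-irrefl refl)
    ... | yes refl | no _ with drop-< d (row j ps) (≤-trans (m≤m+n (suc d) _) (≤-reflexive (trans (sym (+-suc d _)) (sym len))))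
    ...   | y , _ , eq with v<y ∷ cols′ ← subst (Pointwise _<_ _) eq cols
      = ≤-trans (columns⇒ballot (suc d) ps ps↗ (trans len (+-suc d _)) cols′ p) (≤-reflexive (sym (+-suc d _)))
    columns⇒ballot (suc d) ((v , a) ∷ ps) (p≺ ∷ ps↗) len cols (suc p) | no _ | yes refl =
      s≤s (columns⇒ballot d ps ps↗ (suc-injective len) cols p)
    -- With no lead, the first remaining cell of row i would have to be smaller than this cell of
    -- row j, although it is listed later.
    columns⇒ballot zero ((v , a) ∷ ps) (p≺ ∷ ps↗) len cols (suc p) | no _ | yes refl
      with row i ps in eq | cols
    ... | x ∷ _ | x<v ∷ _ = contradiction x<v (≤⇒≯ (≺⇒≤ (All.lookup p≺ (∈-row⁻ i ps (subst (x ∈_) (sym eq) (here refl))))))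
    columns⇒ballot d ((v , a) ∷ ps) (p≺ ∷ ps↗) len cols (suc p) | no _ | no _ =
      columns⇒ballot d ps ps↗ len cols p

    ballot⇒columns : ∀ d ps → AllPairs _≺_ ps →
      length (row j ps) ≡ d + length (row i ps) →
      (∀ p → count j (take p (word ps)) ≤ d + count i (take p (word ps))) →
      Pointwise _<_ (row i ps) (drop d (row j ps))
    ballot⇒columns d [] _ _ _ = subst (Pointwise _<_ []) (sym (drop-[] d)) []
      where
      drop-[] : ∀ d → drop d [] ≡ []
      drop-[] zero    = refl
      drop-[] (suc d) = refl
    -- Abstracting `ballot ∘ suc` along with the comparisons lets the counts in its type reduce once
    -- the first cell is read.
    ballot⇒columns d ((v , a) ∷ ps) (p≺ ∷ ps↗) len ballot with a Fin.≟ i | a Fin.≟ j | ballot ∘ suc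
    ... | yes refl | yes refl | _ = contradiction i<j (<-irrefl refl)
    ... | yes refl | no _ | ballot′ with drop-< d (row j ps) (≤-trans (m≤m+n (suc d) _) (≤-reflexive (trans (sym (+-suc d _)) (sym len))))
    ...   | y , y∈ , eq = subst (Pointwise _<_ _) (sym eq)
      (≺⇒< (<⇒≤ i<j) (All.lookup p≺ (∈-row⁻ j ps y∈)) ∷
       ballot⇒columns (suc d) ps ps↗ (trans len (+-suc d _)) (λ p → ≤-trans (ballot′ p) (≤-reflexive (+-suc d _))))
    ballot⇒columns (suc d) ((v , a) ∷ ps) (p≺ ∷ ps↗) len ballot | no _ | yes refl | ballot′ =
      ballot⇒columns d ps ps↗ (suc-injective len) (≤-pred ∘ ballot′)
    -- With no lead, the prefix consisting of this single step already violates the ballot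
    -- condition.
    ballot⇒columns zero ((v , a) ∷ ps) (p≺ ∷ ps↗) len ballot | no _ | yes refl | ballot′
      with () ← ballot′ 0
    ballot⇒columns d ((v , a) ∷ ps) (p≺ ∷ ps↗) len ballot | no _ | no _ | ballot′ =
      ballot⇒columns d ps ps↗ len ballot′

  -- Chains of cells.

  -- Chain M v a ps: the cells ps continue a list ending in (v , a), up to the
  -- final value M, each value being either repeated in a higher row or increased by 1.
  data Chain (M : ℕ) : ℕ → Fin m → List (Cell m) → Set where
    done : ∀ {a} → Chain M M a []
    new  : ∀ {v a b ps} → Chain M (suc v) b ps → Chain M v a ((suc v , b) ∷ ps)
    same : ∀ {v a b ps} → b Fin.< a → Chain M v b ps → Chain M v a ((v , b) ∷ ps)

  -- Readings hold their chain irrelevantly; deciding it allows `recompute` to recover the chain as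
  -- data.
  chain? : ∀ M v a ps → Dec (Chain M v a ps)
  chain? M v a [] with v ≟ M
  ... | yes refl = yes done
  ... | no  v≢M  = no λ { done → v≢M refl }
  chain? M v a ((u , b) ∷ ps) with u ≟ suc v | u ≟ v | b Fin.<? a | chain? M u b ps
  ... | _        | _        | _       | no ¬c = no λ { (new c) → ¬c c ; (same _ c) → ¬c c }
  ... | yes refl | _        | _       | yes c = yes (new c)
  ... | no _     | yes refl | yes b<a | yes c = yes (same b<a c)
  ... | no _     | yes refl | no b≮a  | yes _ = no λ { (same b<a _) → b≮a b<a }
  ... | no u≢sv  | no u≢v   | _       | yes _ = no λ { (new _) → u≢sv refl ; (same _ _) → u≢v refl }

  chain-≺ : ∀ {M v a ps} → Chain M v a ps → All ((v , a) ≺_) ps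
  chain-≺ done         = []
  chain-≺ (new c)      = inj₁ ≤-refl ∷ All.map (≺-trans (inj₁ ≤-refl)) (chain-≺ c)
  chain-≺ (same b<a c) = inj₂ (refl , b<a) ∷ All.map (≺-trans (inj₂ (refl , b<a))) (chain-≺ c)

  chain-sorted : ∀ {M v a ps} → Chain M v a ps → AllPairs _≺_ ps
  chain-sorted done       = []
  chain-sorted (new c)    = chain-≺ c ∷ chain-sorted c
  chain-sorted (same _ c) = chain-≺ c ∷ chain-sorted c

  chain-bounded : ∀ {M v a ps} → Chain M v a ps → v ≤ M × All ((_≤ M) ∘ proj₁) ps
  chain-bounded done = ≤-refl , []
  chain-bounded (new c) with chain-bounded c
  ... | v<M , bs = <⇒≤ v<M , v<M ∷ bs
  chain-bounded (same _ c) with chain-bounded c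
  ... | v≤M , bs = v≤M , v≤M ∷ bs

  chain-surjective : ∀ {M v a ps} → Chain M v a ps → ∀ u → v < u → u ≤ M → ∃[ b ] (u , b) ∈ ps
  chain-surjective done u v<u u≤v = contradiction v<u (≤⇒≯ u≤v)
  chain-surjective {v = v} (new {b = b} c) u v<u u≤M with suc v ≟ u
  ... | yes refl = b , here refl
  ... | no sv≢u with b′ , u∈ ← chain-surjective c u (≤∧≢⇒< v<u sv≢u) u≤M = b′ , there u∈
  chain-surjective (same _ c) u v<u u≤M with b , u∈ ← chain-surjective c u v<u u≤M = b , there u∈

  -- If the next cell does not tie with the current one, then `suc v` still has to occur, and
  -- sortedness leaves it no place later unless the next cell has that value too.
  sorted⇒chain : ∀ {M} v a ps → v ≤ M → All ((v , a) ≺_) ps → AllPairs _≺_ ps →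
    All ((_≤ M) ∘ proj₁) ps → (∀ u → v < u → u ≤ M → ∃[ b ] (u , b) ∈ ps) → Chain M v a ps
  sorted⇒chain {M} v a [] v≤M _ _ _ surj with v ≟ M
  ... | yes refl = done
  ... | no v≢M with _ , () ← surj M (≤∧≢⇒< v≤M v≢M) ≤-refl
  sorted⇒chain {M} v a ((u , b) ∷ ps) v≤M (q ∷ _) (p≺ ∷ ps↗) (u≤M ∷ bs) surj = step q
    where
    surj′ : v ≤ u → ∀ w → u < w → w ≤ M → ∃[ c ] (w , c) ∈ ps
    surj′ v≤u w u<w w≤M with surj w (≤-<-trans v≤u u<w) w≤M
    ... | _ , here refl = contradiction u<w (<-irrefl refl)
    ... | c , there w∈  = c , w∈
    rest : v ≤ u → Chain M u b ps
    rest v≤u = sorted⇒chain u b ps u≤M p≺ ps↗ bs (surj′ v≤u)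
    step : (v , a) ≺ (u , b) → Chain M v a ((u , b) ∷ ps)
    step (inj₂ (refl , b<a)) = same b<a (rest ≤-refl)
    step (inj₁ v<u) with surj (suc v) ≤-refl (≤-trans v<u u≤M)
    ... | _ , here refl = new (rest (<⇒≤ v<u))
    ... | _ , there w∈ with refl ← ≤-antisym v<u (≺⇒≤ (All.lookup p≺ w∈)) = new (rest (<⇒≤ v<u))

  -- All candidate cells, with the rows reversed by `opposite` so that the list is already in
  -- reading order; filtering it replaces sorting.
  grid : ℕ → List (Cell m)
  grid M = cartesianProduct (applyUpTo suc M) (List.tabulate opposite)

  grid-sorted : ∀ M → AllPairs _≺_ (grid M)
  grid-sorted M = product-sorted (AllPairs.applyUpTo⁺₁ suc M (λ i<j _ → s≤s i<j))
                                 (AllPairs.tabulate⁺-< opposite-antimono)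
    where
    opposite-antimono : ∀ {i j : Fin m} → i Fin.< j → opposite j Fin.< opposite i
    opposite-antimono {i} {j} i<j = subst₂ _<_ (sym (Fin.opposite-prop j)) (sym (Fin.opposite-prop i))
      (∸-monoʳ-< (s≤s i<j) (Fin.toℕ<n j))
    product-sorted : ∀ {vs as} → AllPairs _<_ vs → AllPairs (λ a b → b Fin.< a) as →
      AllPairs _≺_ (cartesianProduct vs as)
    product-sorted [] _ = []
    product-sorted {v ∷ vs} {as} (v< ∷ vs↗) as↘ = AllPairs.++⁺
      (AllPairs.map⁺ (AllPairs.map (λ b<a → inj₂ (refl , b<a)) as↘))
      (product-sorted vs↗ as↘)
      (All.map⁺ (All.tabulate λ _ → All.tabulate λ q∈ →
        inj₁ (All.lookup v< (proj₁ (∈-cartesianProduct⁻ vs as q∈)))))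

  ∈-grid⁺ : ∀ {M v} i → 1 ≤ v → v ≤ M → (v , i) ∈ grid M
  ∈-grid⁺ {v = suc v} i _ v<M = ∈-cartesianProduct⁺ (∈-applyUpTo⁺ suc v<M)
    (subst (_∈ List.tabulate opposite) (Fin.opposite-involutive i) (∈-tabulate⁺ (opposite i)))

  ∈-grid⁻ : ∀ M {v i} → (v , i) ∈ grid M → 1 ≤ v × v ≤ M
  ∈-grid⁻ M vi∈ with _ , v<M , refl ← ∈-applyUpTo⁻ suc (proj₁ (∈-cartesianProduct⁻ (applyUpTo suc M) _ vi∈)) = s≤s z≤n , v<M

-- Vectors and their underlying lists.

toList-injective : ∀ {A : Set} {n} (xs ys : Vec A n) → toList xs ≡ toList ys → xs ≡ ys
toList-injective xs ys eq = trans (sym (Vec.cast-is-id refl xs)) (Vec.toList-injective refl xs ys eq)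

lookup-∈-toList : ∀ {A : Set} {n} (r : Vec A n) j → lookup r j ∈ toList r
lookup-∈-toList (x ∷ r) zero    = here refl
lookup-∈-toList (x ∷ r) (suc j) = there (lookup-∈-toList r j)

∈-toList⇒lookup : ∀ {A : Set} {n} (r : Vec A n) {v} → v ∈ toList r → ∃[ j ] lookup r j ≡ v
∈-toList⇒lookup (x ∷ r) (here refl) = zero , refl
∈-toList⇒lookup (x ∷ r) (there v∈) with j , eq ← ∈-toList⇒lookup r v∈ = suc j , eq

module _ {A : Set} {_∼_ : A → A → Set} where

  sorted⇒lookup : ∀ {n} (r : Vec A n) → AllPairs _∼_ (toList r) →
    ∀ (j j′ : Fin n) → j Fin.< j′ → lookup r j ∼ lookup r j′
  sorted⇒lookup (x ∷ r) (x∼ ∷ _)  zero    (suc j′) _          = All.lookup x∼ (lookup-∈-toList r j′)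
  sorted⇒lookup (x ∷ r) (_ ∷ r↗) (suc j) (suc j′) (s≤s j<j′) = sorted⇒lookup r r↗ j j′ j<j′

  lookup⇒sorted : ∀ {n} (r : Vec A n) →
    (∀ (j j′ : Fin n) → j Fin.< j′ → lookup r j ∼ lookup r j′) → AllPairs _∼_ (toList r)
  lookup⇒sorted []      _   = []
  lookup⇒sorted (x ∷ r) inc =
    All.tabulate (λ v∈ → let j , eq = ∈-toList⇒lookup r v∈ in subst (x ∼_) eq (inc zero (suc j) (s≤s z≤n)))
    ∷ lookup⇒sorted r (λ j j′ j<j′ → inc (suc j) (suc j′) (s≤s j<j′))

  pointwise⇒lookup : ∀ {n} (r s : Vec A n) → Pointwise _∼_ (toList r) (toList s) →
    ∀ j → lookup r j ∼ lookup s j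
  pointwise⇒lookup (x ∷ r) (y ∷ s) (x∼y ∷ _)  zero    = x∼y
  pointwise⇒lookup (x ∷ r) (y ∷ s) (_ ∷ r∼s) (suc j) = pointwise⇒lookup r s r∼s j

  lookup⇒pointwise : ∀ {n} (r s : Vec A n) → (∀ j → lookup r j ∼ lookup s j) →
    Pointwise _∼_ (toList r) (toList s)
  lookup⇒pointwise []      []      _ = []
  lookup⇒pointwise (x ∷ r) (y ∷ s) f = f zero ∷ lookup⇒pointwise r s (f ∘ suc)

lookup-extensional : ∀ {A : Set} {n} (r s : Vec A n) → (∀ j → lookup r j ≡ lookup s j) → r ≡ s
lookup-extensional r s eq =
  trans (sym (Vec.tabulate∘lookup r)) (trans (Vec.tabulate-cong eq) (Vec.tabulate∘lookup s))

-- Total, so that it can be applied when the length is known only irrelevantly.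
pad : ∀ {A : Set} → A → ∀ n → List A → Vec A n
pad d zero    _        = []
pad d (suc n) []       = d ∷ pad d n []
pad d (suc n) (x ∷ xs) = x ∷ pad d n xs

toList-pad : ∀ {A : Set} (d : A) n xs → length xs ≡ n → toList (pad d n xs) ≡ xs
toList-pad d zero    []       _  = refl
toList-pad d (suc n) (x ∷ xs) eq = cong (x ∷_) (toList-pad d n xs (suc-injective eq))

-- Each letter contributes 1 to exactly one of the counts, so the counts add up to the length.
length-by-counts : ∀ {m} n (w : List (Fin m)) → (∀ j → count j w ≡ n) → length w ≡ m * n
length-by-counts {m} n w counts = trans (sym (∑-count w)) (trans (sum-cong-≗ counts) (∑-const m))
  where
  open Sum +-0-commutativeMonoid renaming (sum to ∑)
  ∑-const : ∀ m {x} → ∑ {m} (λ _ → x) ≡ m * x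
  ∑-const zero        = refl
  ∑-const (suc m) {x} = cong (x +_) (∑-const m)
  ∑-indicator : ∀ {m} (a : Fin m) → ∑ (λ j → if does (a Fin.≟ j) then 1 else 0) ≡ 1
  ∑-indicator {suc m} zero    = cong suc (sum-replicate-zero m)
  ∑-indicator {suc m} (suc a) = ∑-indicator a
  ∑-count : ∀ (w : List (Fin m)) → ∑ (λ j → count j w) ≡ length w
  ∑-count []      = sum-replicate-zero m
  ∑-count (a ∷ w) = trans (∑-distrib-+ _ (λ j → count j w)) (cong₂ _+_ (∑-indicator a) (∑-count w))

-- Readings of tableaux.

-- The chain starts from a virtual cell of value 0 in the top row; no row is higher, so the first
-- real cell has value 1. The field `k≤mn` makes the truncated subtraction a true one.
record IsReading (k m n : ℕ) (ps : List (Cell (suc m))) : Set where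
  field
    k≤mn     : k ≤ suc m * n
    chain    : Chain (suc m * n ∸ k) 0 zero ps
    ballot   : ∀ p (i j : Fin (suc m)) → i Fin.< j → count j (take p (word ps)) ≤ count i (take p (word ps))
    endpoint : ∀ j → count j (word ps) ≡ n

record Reading (k m n : ℕ) : Set where
  constructor mkReading
  field
    cells  : List (Cell (suc m))
    .valid : IsReading k m n cells

mkInc-cong : ∀ {k m n t t′} .{v v′} → t ≡ t′ → mkInc {k} {m} {n} t v ≡ mkInc t′ v′
mkInc-cong refl = refl

mkReading-cong : ∀ {k m n ps ps′} .{v v′} → ps ≡ ps′ → mkReading {k} {m} {n} ps v ≡ mkReading ps′ v′
mkReading-cong refl = refl

_≟ᶜ_ : ∀ {m} (ps qs : List (Cell m)) → Dec (ps ≡ qs)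
_≟ᶜ_ = List.≡-dec (Product.≡-dec _≟_ Fin._≟_)

climb : ∀ n (f : Fin (suc n) → ℕ) → (∀ j j′ → j Fin.< j′ → f j < f j′) → f zero + n ≤ f (fromℕ n)
climb zero    f _   = ≤-reflexive (+-identityʳ (f zero))
climb (suc n) f inc = ≤-trans (≤-reflexive (+-suc (f zero) n))
  (≤-trans (+-monoˡ-≤ n (inc zero (suc zero) (s≤s z≤n)))
           (climb n (f ∘ suc) (λ j j′ j<j′ → inc (suc j) (suc j′) (s≤s j<j′))))

module _ {k m n : ℕ} {t : Vec (Vec ℕ (suc n)) (suc m)} (inc : IsIncTableau k (suc m) (suc n) t) where
  open IsIncTableau inc

  -- The corner entry lies between 1 and the maximum, so the truncated difference is not 0.
  inc⇒k≤mn : k ≤ suc m * suc n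
  inc⇒k≤mn = <⇒≤ (m∸n≢0⇒n<m λ eq →
    contradiction (≤-trans (positive zero zero) (≤-trans (bounded zero zero) (≤-reflexive eq))) λ ())

  -- The first row followed by the last column is a chain of m + n + 1 cells.
  inc⇒k≤ : k ≤ m * n
  inc⇒k≤ = +-cancelˡ-≤ (suc n + m) k (m * n) (≤-trans
    (m≤o∸n⇒m+n≤o (suc n + m) inc⇒k≤mn (≤-trans long-chain (bounded (fromℕ m) (fromℕ n))))
    -- The number of cells splits as the chain length `suc n + m` plus `m * n`.
    (≤-reflexive (trans (cong (suc n +_) (*-suc m n)) (sym (+-assoc (suc n) m (m * n))))))
    where
    long-chain : suc n + m ≤ entry t (fromℕ m) (fromℕ n)
    long-chain = ≤-trans
      (+-monoˡ-≤ m (≤-trans (+-monoˡ-≤ n (positive zero zero)) (climb n (entry t zero) (rowsInc zero))))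
      (climb m (λ i → entry t i (fromℕ n)) (λ i i′ → colsInc i i′ (fromℕ n)))

-- Tableaux correspond to readings.

module _ (k m n : ℕ) where

  private
    M : ℕ
    M = suc m * n ∸ k

    occurs? : (t : Vec (Vec ℕ n) (suc m)) (q : Cell (suc m)) → Dec (proj₁ q ∈ toList (lookup t (proj₂ q)))
    occurs? t (v , i) = v ∈? toList (lookup t i)

  cellsOf : Vec (Vec ℕ n) (suc m) → List (Cell (suc m))
  cellsOf t = filter (occurs? t) (grid M)

  tableauOf : List (Cell (suc m)) → Vec (Vec ℕ n) (suc m)
  tableauOf ps = tabulate (λ i → pad 0 n (row i ps))

  toList-tableauOf : ∀ ps i → length (row i ps) ≡ n → toList (lookup (tableauOf ps) i) ≡ row i ps
  toList-tableauOf ps i len = trans (cong toList (Vec.lookup∘tabulate (λ i → pad 0 n (row i ps)) i))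
    (toList-pad 0 n (row i ps) len)

  cellsOf-sorted : ∀ t → AllPairs _≺_ (cellsOf t)
  cellsOf-sorted t = AllPairs.filter⁺ (occurs? t) (grid-sorted M)

  module _ {t : Vec (Vec ℕ n) (suc m)} (inc : IsIncTableau k (suc m) n t) where
    open IsIncTableau inc

    inc-∈⁻ : ∀ {i v} → v ∈ toList (lookup t i) → 1 ≤ v × v ≤ M
    inc-∈⁻ {i} v∈ with j , refl ← ∈-toList⇒lookup (lookup t i) v∈ = positive i j , bounded i j

    ∈-cellsOf : ∀ {i v} → v ∈ toList (lookup t i) → (v , i) ∈ cellsOf t
    ∈-cellsOf {i} v∈ = ∈-filter⁺ (occurs? t) (∈-grid⁺ i (proj₁ (inc-∈⁻ v∈)) (proj₂ (inc-∈⁻ v∈))) v∈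

    row-cellsOf : ∀ i → row i (cellsOf t) ≡ toList (lookup t i)
    row-cellsOf i = sorted-unique <-asym (row-sorted i (cellsOf-sorted t))
      (lookup⇒sorted (lookup t i) (rowsInc i))
      (λ v∈ → proj₂ (∈-filter⁻ (occurs? t) {xs = grid M} (∈-row⁻ i _ v∈)))
      (λ v∈ → ∈-row⁺ i _ (∈-cellsOf v∈))

    length-row-cellsOf : ∀ i → length (row i (cellsOf t)) ≡ n
    length-row-cellsOf i = trans (cong length (row-cellsOf i)) (Vec.length-toList (lookup t i))

    cellsOf-chain : Chain M 0 zero (cellsOf t)
    cellsOf-chain = sorted⇒chain 0 zero (cellsOf t) z≤n
      (All.tabulate (inj₁ ∘ proj₁ ∘ in-range))
      (cellsOf-sorted t)
      (All.tabulate (proj₂ ∘ in-range))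
      (λ u 0<u u≤M → let i , j , eq = surjective u 0<u u≤M
                     in i , ∈-cellsOf (subst (_∈ toList (lookup t i)) eq (lookup-∈-toList (lookup t i) j)))
      where
      in-range : ∀ {q} → q ∈ cellsOf t → 1 ≤ proj₁ q × proj₁ q ≤ M
      in-range q∈ = ∈-grid⁻ M (proj₁ (∈-filter⁻ (occurs? t) {xs = grid M} q∈))

    cellsOf-reading : k ≤ suc m * n → IsReading k m n (cellsOf t)
    cellsOf-reading k≤mn = record
      { k≤mn     = k≤mn
      ; chain    = cellsOf-chain
      ; ballot   = λ p i j i<j → columns⇒ballot i<j 0 (cellsOf t) (cellsOf-sorted t)
          (trans (length-row-cellsOf j) (sym (length-row-cellsOf i)))
          (subst₂ (Pointwise _<_) (sym (row-cellsOf i)) (sym (row-cellsOf j))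
            (lookup⇒pointwise (lookup t i) (lookup t j) (λ c → colsInc i j c i<j))) p
      ; endpoint = λ j → trans (sym (length-row j (cellsOf t))) (length-row-cellsOf j)
      }

    tableauOf-cellsOf : tableauOf (cellsOf t) ≡ t
    tableauOf-cellsOf = lookup-extensional _ t λ i → toList-injective _ _
      (trans (toList-tableauOf (cellsOf t) i (length-row-cellsOf i)) (row-cellsOf i))

  module _ {ps : List (Cell (suc m))} (reading : IsReading k m n ps) where
    open IsReading reading

    private
      t : Vec (Vec ℕ n) (suc m)
      t = tableauOf ps

      sorted : AllPairs _≺_ ps
      sorted = chain-sorted chain

    length-row-reading : ∀ i → length (row i ps) ≡ n
    length-row-reading i = trans (length-row i ps) (endpoint i)

    toList-lookup : ∀ i → toList (lookup t i) ≡ row i ps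
    toList-lookup i = toList-tableauOf ps i (length-row-reading i)

    ∈-tableauOf⁻ : ∀ i {v} → v ∈ toList (lookup t i) → (v , i) ∈ ps
    ∈-tableauOf⁻ i v∈ = ∈-row⁻ i ps (subst (_ ∈_) (toList-lookup i) v∈)

    ∈-tableauOf⁺ : ∀ i {v} → (v , i) ∈ ps → v ∈ toList (lookup t i)
    ∈-tableauOf⁺ i v∈ = subst (_ ∈_) (sym (toList-lookup i)) (∈-row⁺ i ps v∈)

    -- The chain starts at value 0 in the top row, and a tie with it would need a still higher row.
    cell-positive : ∀ {v i} → (v , i) ∈ ps → 1 ≤ v
    cell-positive = ≺⇒< z≤n ∘ All.lookup (chain-≺ chain)

    cell-bounded : ∀ {v i} → (v , i) ∈ ps → v ≤ M
    cell-bounded = All.lookup (proj₂ (chain-bounded chain))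

    tableauOf-inc : IsIncTableau k (suc m) n t
    tableauOf-inc = record
      { positive   = λ i j → cell-positive (∈-tableauOf⁻ i (lookup-∈-toList (lookup t i) j))
      ; bounded    = λ i j → cell-bounded (∈-tableauOf⁻ i (lookup-∈-toList (lookup t i) j))
      ; rowsInc    = λ i → sorted⇒lookup (lookup t i)
          (subst (AllPairs _<_) (sym (toList-lookup i)) (row-sorted i sorted))
      ; colsInc    = λ i i′ j i<i′ → pointwise⇒lookup (lookup t i) (lookup t i′)
          (subst₂ (Pointwise _<_) (sym (toList-lookup i)) (sym (toList-lookup i′))
            (ballot⇒columns i<i′ 0 ps sorted
              (trans (length-row-reading i′) (sym (length-row-reading i)))
              (λ p → ballot p i i′ i<i′))) j
      ; surjective = λ u 0<u u≤M →
          let i , u∈ = chain-surjective chain u 0<u u≤M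
              j , eq = ∈-toList⇒lookup (lookup t i) (∈-tableauOf⁺ i u∈)
          in i , j , eq
      }

    cellsOf-tableauOf : cellsOf t ≡ ps
    cellsOf-tableauOf = sorted-unique ≺-asym (cellsOf-sorted t) sorted
      (λ {(v , i)} q∈ → ∈-tableauOf⁻ i (proj₂ (∈-filter⁻ (occurs? t) {xs = grid M} q∈)))
      (λ {(v , i)} q∈ → ∈-filter⁺ (occurs? t) (∈-grid⁺ i (cell-positive q∈) (cell-bounded q∈)) (∈-tableauOf⁺ i q∈))

-- Validity is irrelevant, so the round-trip equations that depend on it are recovered from
-- decidable equality by `recompute`.
inc↔reading : ∀ k m n → Inc k (suc m) (suc n) ↔ Reading k m (suc n)
inc↔reading k m n = mk↔ₛ′
  (λ (mkInc t inc) → mkReading (cellsOf k m (suc n) t) (cellsOf-reading k m (suc n) inc (inc⇒k≤mn inc)))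
  (λ (mkReading ps r) → mkInc (tableauOf k m (suc n) ps) (tableauOf-inc k m (suc n) r))
  (λ (mkReading ps r) → mkReading-cong (recompute (_ ≟ᶜ ps) (cellsOf-tableauOf k m (suc n) r)))
  (λ (mkInc t inc) → mkInc-cong (recompute (Vec.≡-dec (Vec.≡-dec _≟_) _ t) (tableauOf-cellsOf k m (suc n) inc)))

-- Counting choices of ascents.

-- Marked a w k: a choice of k of the ascents of the word a ∷ w.
data Marked {m : ℕ} : Fin m → List (Fin m) → ℕ → Set where
  done : ∀ {a} → Marked a [] 0
  new  : ∀ {a b w k} → Marked b w k → Marked a (b ∷ w) k
  same : ∀ {a b w k} → .(b Fin.< a) → Marked b w k → Marked a (b ∷ w) (suc k)

Fin-cong : ∀ {m n} → m ≡ n → Fin m ↔ Fin n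
Fin-cong refl = ↔-refl

nC0≡1 : ∀ n → n C 0 ≡ 1
nC0≡1 zero    = refl
nC0≡1 (suc n) = refl

-- An ascent is either chosen or not, which is Pascal's rule; a non-ascent cannot be chosen. The
-- decision is an argument so that matching on it reduces the ascent count.
marked-∷↔Fin : ∀ {m} {a b : Fin m} {w} {s} (b<?a : Dec (b Fin.< a)) →
  (∀ k → Marked b w k ↔ Fin (s C k)) →
  ∀ k → Marked a (b ∷ w) k ↔ Fin (((if does b<?a then 1 else 0) + s) C k)
marked-∷↔Fin {a = a} {b} {w} (no b≮a) ih k = ↔-trans unmarked (ih k)
  where
  unmarked : Marked a (b ∷ w) k ↔ Marked b w k
  unmarked = mk↔ₛ′
    (λ { (new x) → x ; (same b<a _) → ⊥-elim-irr (b≮a b<a) }) new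
    (λ _ → refl) (λ { (new x) → refl ; (same b<a _) → ⊥-elim-irr (b≮a b<a) })
-- Pascal's rule covers only positive k; for k = 0 both binomials are 1.
marked-∷↔Fin {a = a} {b} {w} {s} (yes _) ih zero = ↔-trans unmarked (↔-trans (ih 0) (Fin-cong (nC0≡1 s)))
  where
  unmarked : Marked a (b ∷ w) 0 ↔ Marked b w 0
  unmarked = mk↔ₛ′ (λ { (new x) → x }) new (λ _ → refl) (λ { (new x) → refl })
marked-∷↔Fin {a = a} {b} {w} {s} (yes b<a) ih (suc k) = ↔-trans split
  (↔-trans (ih k ⊎-↔ ih (suc k))
    (↔-trans (↔-sym Fin.+↔⊎) (Fin-cong (nCk+nC[k+1]≡[n+1]C[k+1] s k))))
  where
  split : Marked a (b ∷ w) (suc k) ↔ (Marked b w k ⊎ Marked b w (suc k))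
  split = mk↔ₛ′
    (λ { (new x) → inj₂ x ; (same _ x) → inj₁ x })
    (λ { (inj₁ x) → same b<a x ; (inj₂ x) → new x })
    (λ { (inj₁ _) → refl ; (inj₂ _) → refl })
    (λ { (new _) → refl ; (same _ _) → refl })

marked↔Fin : ∀ {m} (a : Fin m) w k → Marked a w k ↔ Fin (ascents (a ∷ w) C k)
marked↔Fin a []      zero    = mk↔ₛ′ (λ _ → zero) (λ _ → done) (λ { zero → refl }) (λ { done → refl })
marked↔Fin a []      (suc k) = ↔-trans (mk↔ₛ′ (λ ()) (λ ()) (λ ()) (λ ()))
  (Fin-cong (sym (k>n⇒nCk≡0 (s≤s (z≤n {k})))))
marked↔Fin a (b ∷ w) k       = marked-∷↔Fin (b Fin.<? a) (marked↔Fin b w) k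

-- From marked words to chains and back.

module _ {m : ℕ} where

  decorate : ∀ {a : Fin m} {w k} → ℕ → Marked a w k → List (Cell m)
  decorate v done               = []
  decorate v (new {b = b} x)    = (suc v , b) ∷ decorate (suc v) x
  decorate v (same {b = b} _ x) = (v , b) ∷ decorate v x

  word-decorate : ∀ {a : Fin m} {w k} v (x : Marked a w k) → word (decorate v x) ≡ w
  word-decorate v done       = refl
  word-decorate v (new x)    = cong (_ ∷_) (word-decorate (suc v) x)
  word-decorate v (same _ x) = cong (_ ∷_) (word-decorate v x)

  -- The marks can be read off the values: a marked letter repeats the current value and an unmarked
  -- one raises it.
  decorate-injective : ∀ {a : Fin m} {w k} v (x y : Marked a w k) → decorate v x ≡ decorate v y → x ≡ y
  decorate-injective v done       done       _  = refl
  decorate-injective v (new x)    (new y)    eq = cong new (decorate-injective (suc v) x y (List.∷-injectiveʳ eq))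
  decorate-injective v (same p x) (same _ y) eq = cong (same p) (decorate-injective v x y (List.∷-injectiveʳ eq))
  decorate-injective v (new x)    (same _ y) eq = contradiction (cong proj₁ (List.∷-injectiveˡ eq)) 1+n≢n
  decorate-injective v (same _ x) (new y)    eq = contradiction (sym (cong proj₁ (List.∷-injectiveˡ eq))) 1+n≢n

  marks≤length : ∀ {a : Fin m} {w k} → Marked a w k → k ≤ length w
  marks≤length done       = z≤n
  marks≤length (new x)    = m≤n⇒m≤1+n (marks≤length x)
  marks≤length (same _ x) = s≤s (marks≤length x)

  -- Every letter except the k marked ones raises the value by 1, which fixes the final value; the
  -- equation says so without subtraction.
  decorate-chain : ∀ {a : Fin m} {w k M} v (x : Marked a w k) →
    M + k ≡ v + length w → Chain M v a (decorate v x)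
  decorate-chain {M = M} v done eq
    with refl ← trans (sym (+-identityʳ M)) (trans eq (+-identityʳ v)) = done
  decorate-chain v (new x) eq = new (decorate-chain (suc v) x (trans eq (+-suc v _)))
  decorate-chain {a} {M = M} v (same {b = b} b<a x) eq = same (recompute (b Fin.<? a) b<a)
    (decorate-chain v x (suc-injective (trans (sym (+-suc M _)) (trans eq (+-suc v _)))))

  -- The marks are the `same` steps. Their number is found along the way, and the length equation
  -- later identifies it with the prescribed k.
  chain⇒marked : ∀ {M v} {a : Fin m} {ps} → Chain M v a ps →
    ∃[ k ] Σ[ x ∈ Marked a (word ps) k ] M + k ≡ v + length ps × decorate v x ≡ ps
  chain⇒marked done = 0 , done , refl , refl
  chain⇒marked {v = v} (new c) with k , x , len , eq ← chain⇒marked c =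
    k , new x , trans len (sym (+-suc v _)) , cong (_ ∷_) eq
  chain⇒marked {M} {v} (same b<a c) with k , x , len , eq ← chain⇒marked c =
    suc k , same b<a x , trans (+-suc M k) (trans (cong suc len) (sym (+-suc v _))) , cong (_ ∷_) eq

  decorate-subst₂ : ∀ {a : Fin m} {w w′ k k′} v (p : w ≡ w′) (q : k ≡ k′) (x : Marked a w k) →
    decorate v (subst₂ (Marked a) p q x) ≡ decorate v x
  decorate-subst₂ v refl refl x = refl

-- Readings correspond to marked paths.

record Path (m n : ℕ) : Set where
  constructor mkPath
  field
    steps  : Vec (Fin m) (m * n)
    .valid : IsPath m n steps

-- Prefixing the letter zero creates no ascent, and forces the first cell to be new.
MarkedPath : (k m n : ℕ) → Set
MarkedPath k m n = Σ[ P ∈ Path (suc m) n ] Marked zero (toList (Path.steps P)) k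

module _ (k m n : ℕ) where

  private
    N M : ℕ
    N = suc m * n
    M = N ∸ k

  module _ (steps : Vec (Fin (suc m)) N) (valid : IsPath (suc m) n steps)
           (x : Marked zero (toList steps) k) where
    open IsPath valid

    decorate-reading : IsReading k m n (decorate 0 x)
    decorate-reading = record
      { k≤mn     = k≤N
      ; chain    = decorate-chain 0 x (trans (m∸n+n≡m k≤N) (sym len))
      ; ballot   = λ p i j i<j → subst (λ w → count j (take p w) ≤ count i (take p w))
                     (sym (word-decorate 0 x)) (inRegion p i j i<j)
      ; endpoint = λ j → trans (cong (count j) (word-decorate 0 x)) (endpoint j)
      }
      where
      len : length (toList steps) ≡ N
      len = Vec.length-toList steps
      k≤N : k ≤ N
      k≤N = subst (k ≤_) len (marks≤length x)

  module _ (ps : List (Cell (suc m))) (reading : IsReading k m n ps) where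
    open IsReading reading

    length-word : length (word ps) ≡ N
    length-word = length-by-counts n (word ps) endpoint

    toList-steps : toList (pad zero N (word ps)) ≡ word ps
    toList-steps = toList-pad zero N (word ps) length-word

    marks≡k : ∀ {k′} → M + k′ ≡ length ps → k′ ≡ k
    marks≡k {k′} eq = +-cancelˡ-≡ M k′ k
      (trans eq (trans (sym (List.length-map proj₂ ps)) (trans length-word (sym (m∸n+n≡m k≤mn)))))

    steps-path : IsPath (suc m) n (pad zero N (word ps))
    steps-path = record
      { inRegion = λ p i j i<j → subst (λ w → count j (take p w) ≤ count i (take p w))
                     (sym toList-steps) (ballot p i j i<j)
      ; endpoint = λ j → trans (cong (count j) toList-steps) (endpoint j)
      }

  -- The marks are data but the validity is irrelevant, so the chain and both index equations pass
  -- through `recompute`. Keeping the equation with the marks supplies one round trip.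
  reading⇒marked : (ps : List (Cell (suc m))) → .(IsReading k m n ps) →
    Σ[ x ∈ Marked zero (toList (pad zero N (word ps))) k ] decorate 0 x ≡ ps
  reading⇒marked ps r with chain⇒marked (recompute (chain? M 0 zero ps) (IsReading.chain r))
  ... | k′ , x , len , eq = subst₂ (Marked zero) w≡ k≡ x , trans (decorate-subst₂ 0 w≡ k≡ x) eq
    where
    w≡ : word ps ≡ toList (pad zero N (word ps))
    w≡ = sym (recompute (List.≡-dec Fin._≟_ _ _) (toList-steps ps r))
    k≡ : k′ ≡ k
    k≡ = recompute (k′ ≟ k) (marks≡k ps r len)

  markedPath⇒reading : MarkedPath k m n → Reading k m n
  markedPath⇒reading (mkPath s valid , x) = mkReading (decorate 0 x) (decorate-reading s valid x)

  reading⇒markedPath : Reading k m n → MarkedPath k m n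
  reading⇒markedPath (mkReading ps r) = mkPath (pad zero N (word ps)) (steps-path ps r) , proj₁ (reading⇒marked ps r)

  -- The rows of the cells give back the path, and then their values give back the marks.
  markedPath⇒reading-injective : ∀ {x y} → markedPath⇒reading x ≡ markedPath⇒reading y → x ≡ y
  markedPath⇒reading-injective {mkPath s _ , x} {mkPath s′ _ , y} eq with cells≡ ← cong Reading.cells eq
    with refl ← toList-injective s s′
           (trans (sym (word-decorate 0 x)) (trans (cong word cells≡) (word-decorate 0 y)))
    with refl ← decorate-injective 0 x y cells≡ = refl

  markedPath⇒reading∘reading⇒markedPath : ∀ r → markedPath⇒reading (reading⇒markedPath r) ≡ r
  markedPath⇒reading∘reading⇒markedPath (mkReading ps r) = mkReading-cong (proj₂ (reading⇒marked ps r))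

  reading↔markedPath : Reading k m n ↔ MarkedPath k m n
  reading↔markedPath = mk↔ₛ′ reading⇒markedPath markedPath⇒reading
    -- Injectivity derives this round trip from the other one, with no computation on the
    -- transported marks.
    (λ _ → markedPath⇒reading-injective (markedPath⇒reading∘reading⇒markedPath _))
    markedPath⇒reading∘reading⇒markedPath

-- Grading paths by ascents.

ascents-zero∷ : ∀ {m} (w : List (Fin (suc m))) → ascents (zero ∷ w) ≡ ascents w
ascents-zero∷ []      = refl
ascents-zero∷ (b ∷ w) = refl

inc↔markedPath : ∀ k m n → Inc k (suc m) (suc n) ↔ MarkedPath k m (suc n)
inc↔markedPath k m n = ↔-trans (inc↔reading k m n) (reading↔markedPath k m (suc n))

-- Marking all the ascents yields an increasing tableau, to which inc⇒k≤ applies.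
ascents≤ : ∀ m n (P : Path (suc m) (suc n)) → ascents (toList (Path.steps P)) ≤ m * n
ascents≤ m n P@(mkPath s _) = bound tableau
  where
  ℓ : ℕ
  ℓ = ascents (toList s)
  bound : ∀ {k} → Inc k (suc m) (suc n) → k ≤ m * n
  bound {k} (mkInc _ inc) = recompute (k ≤? m * n) (inc⇒k≤ inc)
  all-marked : Marked zero (toList s) ℓ
  -- All ascents can be chosen in exactly one way, as `ℓ C ℓ` is 1.
  all-marked = Inverse.from (marked↔Fin zero (toList s) ℓ)
    (subst Fin (sym (trans (cong (_C ℓ) (ascents-zero∷ (toList s))) (nCn≡1 ℓ))) zero)
  tableau : Inc ℓ (suc m) (suc n)
  tableau = Inverse.from (inc↔markedPath ℓ m n) (P , all-marked)

PathsByAscents : (m n : ℕ) → Set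
PathsByAscents m n = Σ[ ℓ ∈ Fin (suc (m * n)) ] PathAsc (suc m) (suc n) (toℕ ℓ)

-- The bound `ascents≤` is what makes the number of ascents a finite index.
path↔byAscents : ∀ m n → Path (suc m) (suc n) ↔ PathsByAscents m n
path↔byAscents m n = mk↔ₛ′
  (λ P@(mkPath s v) → fromℕ< (s≤s (ascents≤ m n P)) , mkPath s v (sym (Fin.toℕ-fromℕ< _)))
  (λ (_ , mkPath s v _) → mkPath s v)
  (λ (ℓ , mkPath s v asc) → pair-cong (Fin.toℕ-injective
    (trans (Fin.toℕ-fromℕ< _) (recompute (_ ≟ toℕ ℓ) asc))))
  (λ _ → refl)
  where
  pair-cong : ∀ {ℓ ℓ′ : Fin (suc (m * n))} {s} .{v v′ asc asc′} → ℓ ≡ ℓ′ →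
    _≡_ {A = PathsByAscents m n} (ℓ , mkPath s v asc) (ℓ′ , mkPath s v′ asc′)
  pair-cong refl = refl

-- Summation over the number of ascents.

Σ-Fin↔ : ∀ (f : ℕ → ℕ) B → (Σ[ ℓ ∈ Fin B ] Fin (f (toℕ ℓ))) ↔ Fin (sum (applyUpTo f B))
Σ-Fin↔ f zero    = mk↔ₛ′ (λ ()) (λ ()) (λ ()) (λ ())
Σ-Fin↔ f (suc B) = ↔-trans split (↔-trans (↔-refl ⊎-↔ Σ-Fin↔ (f ∘ suc) B) (↔-sym Fin.+↔⊎))
  where
  split : (Σ[ ℓ ∈ Fin (suc B) ] Fin (f (toℕ ℓ))) ↔ (Fin (f 0) ⊎ (Σ[ ℓ ∈ Fin B ] Fin (f (suc (toℕ ℓ)))))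
  split = mk↔ₛ′
    (λ { (zero , x) → inj₁ x ; (suc ℓ , x) → inj₂ (ℓ , x) })
    (λ { (inj₁ x) → zero , x ; (inj₂ (ℓ , x)) → suc ℓ , x })
    (λ { (inj₁ _) → refl ; (inj₂ _) → refl })
    (λ { (zero , _) → refl ; (suc _ , _) → refl })

-- Serves to start the sum at k: the binomials `ℓ C k` vanish for smaller ℓ.
sum-skip-zeros : ∀ k B (h : ℕ → ℕ) → (∀ ℓ → ℓ < k → h ℓ ≡ 0) →
  sum (applyUpTo h B) ≡ sum (applyUpTo (h ∘ (k +_)) (B ∸ k))
sum-skip-zeros zero    B       h _ = refl
sum-skip-zeros (suc k) zero    h _ = refl
sum-skip-zeros (suc k) (suc B) h h≡0 = cong₂ _+_ (h≡0 0 (s≤s z≤n))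
  (sum-skip-zeros k B (h ∘ suc) (λ ℓ ℓ<k → h≡0 (suc ℓ) (s≤s ℓ<k)))

theorem2p4 : (m n k : ℕ) → 2 ≤ m → 1 ≤ n →
    -- N ℓ is the m-Narayana number N(m,n,ℓ) = |{paths in C(m,n) with ℓ ascents}|
    (N : ℕ → ℕ) → (∀ ℓ → PathAsc m n ℓ ↔ Fin (N ℓ)) →
    -- |Inc_k(m × n)| = Σ_{ℓ=k}^{(m-1)(n-1)} binom(ℓ,k) N(m,n,ℓ)
    Inc k m n ↔ Fin (rhsSum m n k N)
theorem2p4 (suc m) (suc n) k _ _ N narayana =
  ↔-trans (inc↔markedPath k m n) (↔-trans by-ascents (↔-trans counted
  (↔-trans (Σ-Fin↔ h B) (Fin-cong (trans
    (sum-skip-zeros k B h (λ ℓ ℓ<k → cong (_* N ℓ) (k>n⇒nCk≡0 ℓ<k)))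
    (cong sum (sym (List.map-upTo (h ∘ (k +_)) (B ∸ k)))))))))
  where
  B : ℕ
  B = suc (m * n)
  h : ℕ → ℕ
  h ℓ = (ℓ C k) * N ℓ
  -- The binomial is stated at the index assigned by `path↔byAscents`, since `Σ-↔` compares fibres
  -- over that image.
  marks : ∀ (P : Path (suc m) (suc n)) → Marked zero (toList (Path.steps P)) k ↔
    Fin (toℕ (proj₁ (Inverse.to (path↔byAscents m n) P)) C k)
  marks P = ↔-trans (marked↔Fin zero (toList (Path.steps P)) k)
    (Fin-cong (cong (_C k) (trans (ascents-zero∷ (toList (Path.steps P))) (sym (Fin.toℕ-fromℕ< _)))))
  by-ascents : MarkedPath k m (suc n) ↔
    (Σ[ ℓ ∈ Fin B ] PathAsc (suc m) (suc n) (toℕ ℓ) × Fin (toℕ ℓ C k))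
  by-ascents = ↔-trans
    (Σ-↔ {B = λ (ℓ , _) → Fin (toℕ ℓ C k)} (path↔byAscents m n) (λ {P} → marks P)) Σ-assoc
  counted : (Σ[ ℓ ∈ Fin B ] PathAsc (suc m) (suc n) (toℕ ℓ) × Fin (toℕ ℓ C k)) ↔
    (Σ[ ℓ ∈ Fin B ] Fin (h (toℕ ℓ)))
  -- The factors are swapped so that the product has the binomial first, as in `h`.
  counted = Σ-↔ ↔-refl (λ {ℓ} → ↔-trans (×-comm _ _)
    (↔-trans (↔-refl ×-↔ narayana (toℕ ℓ)) (↔-sym Fin.*↔×)))
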